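{- Let $\mathbb{F}$ be a field and $n \ge 1$. Let $S_n^{n-1}(x_1,\ldots,x_n) = \sum_{A \subseteq [n], |A| = n-1} \prod_{i \in A} x_i$ be the $n$-variate elementary symmetric polynomial of degree $n-1$. Then $S_n^{n-1}$ cannot be written as a sum of fewer than $\lceil n/2 \rceil$ read-once polynomials over $\mathbb{F}$, but it can be written as a sum of $\lceil n/2 \rceil$ read-once polynomials over $\mathbb{F}$.
   Context: A read-once formula (ROF) over a field $\mathbb{F}$ in variables $x_1,\ldots,x_n$ is a binary tree whose leaves are labeled by variables and whose internal nodes are labeled by $+$ or $\times$; every node additionally carries a pair $(\alpha,\beta) \in \mathbb{F}^2$, and each variable labels at most one leaf. A leaf labeled $x_i$ with pair $(\alpha,\beta)$ computes $\alpha x_i + \beta$; an internal node labeled $\star \in \{+,\times\}$ with pair $(\alpha,\beta)$ whose children compute $f_1,f_2$ computes $\alpha(f_1 \star f_2) + \beta$. A read-once polynomial (ROP) is a polynomial computed by some ROF (constants are also regarded as ROPs). -}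

module Defs where

open import Level using (Level; _⊔_; suc)
open import Algebra.Bundles using (CommutativeRing)
open import Data.Nat using (ℕ; zero; _∸_; _≟_)
import Data.Nat as Nat
open import Data.Bool using (Bool; true; false)
open import Data.Fin using (Fin)
import Data.Fin as Fin
open import Data.Fin.Subset using (Subset; ∣_∣)
open import Data.List using (List; []; _∷_; _++_; map; filter; foldr)
open import Data.List.Relation.Unary.Unique.Propositional using (Unique)
open import Data.Vec using (Vec; []; _∷_)
import Data.Vec as Vec
open import Data.Product using (Σ; ∃; _×_)
open import Data.Sum using (_⊎_)
open import Relation.Nullary using (¬_)

record Field (c ℓ : Level) : Set (Level.suc (c ⊔ ℓ)) where
  field
    commutativeRing : CommutativeRing c ℓ
  open CommutativeRing commutativeRing public
  field
    0≉1     : ¬ (0# ≈ 1#)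
    inverse : ∀ x → ¬ (x ≈ 0#) → Σ Carrier (λ y → x * y ≈ 1#)

allSubsets : (n : ℕ) → List (Subset n)
allSubsets zero    = [] ∷ []
allSubsets (Nat.suc n) =
  map (true ∷_) (allSubsets n) ++ map (false ∷_) (allSubsets n)

-- The polynomial ring F[x₁,…,xₙ], constructed as the free commutative
-- F-algebra on n generators: polynomial expressions modulo the smallest
-- congruence containing the commutative-ring axioms and making
-- a ↦ const a a ring homomorphism F → F[x].

module Poly {c ℓ : Level} (F : Field c ℓ) where
  private module F = Field F

  infixl 6 _+_
  infixl 7 _*_
  infix  4 _≋_

  data Expr (n : ℕ) : Set c where
    var   : Fin n → Expr n
    const : F.Carrier → Expr n
    _+_   : Expr n → Expr n → Expr n
    _*_   : Expr n → Expr n → Expr n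
    neg   : Expr n → Expr n

  data _≋_ {n : ℕ} : Expr n → Expr n → Set (c ⊔ ℓ) where
    ≋-refl  : ∀ {p} → p ≋ p
    ≋-sym   : ∀ {p q} → p ≋ q → q ≋ p
    ≋-trans : ∀ {p q r} → p ≋ q → q ≋ r → p ≋ r
    +-cong  : ∀ {p p′ q q′} → p ≋ p′ → q ≋ q′ → p + q ≋ p′ + q′
    *-cong  : ∀ {p p′ q q′} → p ≋ p′ → q ≋ q′ → p * q ≋ p′ * q′
    neg-cong : ∀ {p q} → p ≋ q → neg p ≋ neg q
    +-assoc : ∀ p q r → (p + q) + r ≋ p + (q + r)
    +-comm  : ∀ p q → p + q ≋ q + p
    +-identityˡ : ∀ p → const F.0# + p ≋ p
    -‿inverseˡ  : ∀ p → neg p + p ≋ const F.0#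
    *-assoc : ∀ p q r → (p * q) * r ≋ p * (q * r)
    *-comm  : ∀ p q → p * q ≋ q * p
    *-identityˡ : ∀ p → const F.1# * p ≋ p
    distribˡ : ∀ p q r → p * (q + r) ≋ p * q + p * r
    const-cong : ∀ {a b} → a F.≈ b → const a ≋ const b
    const-+ : ∀ a b → const (a F.+ b) ≋ const a + const b
    const-* : ∀ a b → const (a F.* b) ≋ const a * const b

  sumE : ∀ {n k} → Vec (Expr n) k → Expr n
  sumE = Vec.foldr _ _+_ (const F.0#)

  monomial : ∀ {n} → Subset n → Expr n
  monomial {n} A = Vec.foldr _ _*_ (const F.1#)
    (Vec.map (λ i → if-in (Vec.lookup A i) i) (Vec.allFin n))
    where
      if-in : Bool → Fin n → Expr n
      if-in true  i = var i
      if-in false i = const F.1#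

  esym : (n d : ℕ) → Expr n
  esym n d = foldr _+_ (const F.0#)
    (map monomial (filter (λ A → ∣ A ∣ ≟ d) (allSubsets n)))

  data Op : Set where
    plus times : Op

  data ROF (n : ℕ) : Set c where
    leaf : Fin n → (α β : F.Carrier) → ROF n
    node : Op → ROF n → ROF n → (α β : F.Carrier) → ROF n

  leaves : ∀ {n} → ROF n → List (Fin n)
  leaves (leaf i _ _)       = i ∷ []
  leaves (node _ l r _ _)   = leaves l ++ leaves r

  ReadOnce : ∀ {n} → ROF n → Set
  ReadOnce t = Unique (leaves t)

  ⟦_⟧ : ∀ {n} → ROF n → Expr n
  ⟦ leaf i α β ⟧           = const α * var i + const β
  ⟦ node plus  l r α β ⟧   = const α * (⟦ l ⟧ + ⟦ r ⟧) + const β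
  ⟦ node times l r α β ⟧   = const α * (⟦ l ⟧ * ⟦ r ⟧) + const β

  IsROP : ∀ {n} → Expr n → Set (c ⊔ ℓ)
  IsROP {n} p = (Σ F.Carrier λ a → p ≋ const a)
              ⊎ (Σ (ROF n) λ t → ReadOnce t × (p ≋ ⟦ t ⟧))

{-# OPTIONS --safe #-}
module Submission where

-- Lower bound.  Put M_L^{α,β} = α ∏_L + β S_L, where S_L is the elementary symmetric polynomial of
-- degree |L| - 1 in the variables L, and take β ≠ 0.  For distinct i, j and M = M_{i,j,L}^{α,β},
--   ∂ᵢ∂ⱼ M = M_L^{α,β}   and   (∂ᵢ M)|_{xⱼ = γ} = M_L^{αγ+β, βγ}.
-- If M_L is a sum of k read-once polynomials with 2k < |L|, and some summand is annihilated by such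
-- an operation (with γ ≠ 0 in the second case), then k drops by one and |L| by two, and β stays
-- nonzero.  If no summand is annihilated by any of them, then no summand contains the monomial
-- ∏_{L∖i}: walking down its formula towards the leaf xᵢ, every + gate would be annihilated by some
-- ∂ᵢ∂ⱼ, and a × gate with a child a xᵢ + b, b ≠ 0, by ∂ⱼ followed by xᵢ = - b / a.  So β = 0.
-- Upper bound.  S_{i,j,L} = (xᵢ + xⱼ) ∏_L + xᵢ xⱼ S_L, iterated.
--
-- Polynomials are studied through their values: partial derivatives of multilinear polynomials are
-- differences of values at 1 and 0.  Equality in F need not be decidable, hence the double negations.

open import Defs
open import Level using (Level; _⊔_)
open import Algebra.Bundles using (CommutativeRing)
import Algebra.Properties.Ring as RingProperties
import Algebra.Solver.Ring.NaturalCoefficients.Default as SemiringSolver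
open import Data.Bool using (Bool; true; false; if_then_else_)
open import Data.Empty using (⊥; ⊥-elim)
open import Data.Fin as Fin using (Fin; zero; suc)
import Data.Fin.Properties as Fin
open import Data.Fin.Subset using (Subset; ∣_∣)
open import Data.List using (List; []; _∷_; _++_; map; filter; foldr; tabulate; allFin; length)
import Data.List.Properties as List
open import Data.List.Membership.Propositional using (_∈_; _∉_)
open import Data.List.Membership.Propositional.Properties
  using (∈-∃++; ∈-++⁺ˡ; ∈-++⁺ʳ; ∈-allFin)
open import Data.List.Relation.Binary.Permutation.Propositional
  using (_↭_; ↭⇒↭ₛ; refl; prep; swap; trans; ↭-sym)
open import Data.List.Relation.Binary.Permutation.Propositional.Properties
  using (shift; ↭-length; ∈-resp-↭; All-resp-↭; map⁺)
import Data.List.Relation.Binary.Permutation.Setoid.Properties as Permutationₛ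
import Data.List.Relation.Binary.Pointwise as Pointwise
import Data.List.Relation.Ternary.Interleaving as Interleaving
open import Data.List.Relation.Ternary.Interleaving.Propositional
  using (Interleaving; []; consˡ; consʳ)
open import Data.List.Relation.Unary.All as ListAll using ([]; _∷_)
  renaming (All to ListAll)
open import Data.List.Relation.Unary.All.Properties using (All¬⇒¬Any; ++⁻ˡ; ++⁻ʳ)
  renaming (map⁺ to ListAll-map⁺)
open import Data.List.Relation.Unary.AllPairs using ([]; _∷_)
open import Data.List.Relation.Unary.Any using (here; there)
open import Data.List.Relation.Unary.Unique.Propositional using (Unique)
open import Data.List.Relation.Unary.Unique.Propositional.Properties using (allFin⁺)
open import Data.Nat as ℕ
  using (ℕ; zero; suc; z≤n; s≤s; _≡ᵇ_; _≟_; _≤_; _<_; _∸_; ⌈_/2⌉)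
import Data.Nat.Properties as ℕ
open import Data.Product using (Σ; ∃; _×_; _,_; proj₁; proj₂)
open import Data.Sum as Sum using (_⊎_; inj₁; inj₂; [_,_])
open import Data.Vec as Vec using (Vec; []; _∷_)
open import Data.Vec.Functional using (updateAt)
open import Data.Vec.Functional.Properties using (updateAt-updates; updateAt-minimal)
import Data.Vec.Properties as Vec
open import Data.Vec.Relation.Unary.All using (All; []; _∷_)
open import Function using (_∘_; id) renaming (const to K)
open import Relation.Binary.PropositionalEquality as ≡ using (_≡_; _≢_; subst)
open import Relation.Nullary using (¬_; Dec; yes; no)
open import Relation.Nullary.Decidable using (_⊎-dec_)

Unique-resp-↭ : ∀ {a} {A : Set a} {xs ys : List A} → xs ↭ ys → Unique xs → Unique ys
Unique-resp-↭ p = Permutationₛ.Unique-resp-↭ (≡.setoid _) (↭⇒↭ₛ p)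

-- Elementary symmetric sums in an arbitrary commutative ring.

module SymmetricSums {c ℓ : Level} (R : CommutativeRing c ℓ) where
  open CommutativeRing R hiding (zero) renaming (refl to ≈-refl; trans to ≈-trans; sym to ≈-sym)
  open SemiringSolver commutativeSemiring using (solve; _:=_; _:+_; _:*_)
  open import Relation.Binary.Reasoning.Setoid setoid

  ∏ : List Carrier → Carrier
  ∏ = foldr _*_ 1#

  -- the elementary symmetric polynomial of degree (length xs ∸ 1), but 0# at []
  σ : List Carrier → Carrier
  σ []       = 0#
  σ (x ∷ xs) = ∏ xs + x * σ xs

  ∏-++ : ∀ xs ys → ∏ (xs ++ ys) ≈ ∏ xs * ∏ ys
  ∏-++ []       ys = ≈-sym (*-identityˡ _)
  ∏-++ (x ∷ xs) ys = ≈-trans (*-congˡ (∏-++ xs ys)) (≈-sym (*-assoc _ _ _))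

  ∏-↭ : ∀ {xs ys} → xs ↭ ys → ∏ xs ≈ ∏ ys
  ∏-↭ refl         = ≈-refl
  ∏-↭ (prep x p)   = *-congˡ (∏-↭ p)
  ∏-↭ (swap x y p) = ≈-trans (*-congˡ (*-congˡ (∏-↭ p)))
    (solve 3 (λ x y z → x :* (y :* z) := y :* (x :* z)) ≈-refl x y _)
  ∏-↭ (trans p q)  = ≈-trans (∏-↭ p) (∏-↭ q)

  σ-↭ : ∀ {xs ys} → xs ↭ ys → σ xs ≈ σ ys
  σ-↭ refl         = ≈-refl
  σ-↭ (prep x p)   = +-cong (∏-↭ p) (*-congˡ (σ-↭ p))
  σ-↭ (swap x y p) = ≈-trans
    (+-cong (*-congˡ (∏-↭ p)) (*-congˡ (+-cong (∏-↭ p) (*-congˡ (σ-↭ p)))))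
    (solve 4 (λ x y z s → y :* z :+ x :* (z :+ y :* s) := x :* z :+ y :* (z :+ x :* s))
      ≈-refl x y _ _)
  σ-↭ (trans p q)  = ≈-trans (σ-↭ p) (σ-↭ q)

  pick : Bool → Carrier → Carrier
  pick b x = if b then x else 1#

  mon : ∀ {m} → (Fin m → Carrier) → Subset m → Carrier
  mon v []      = 1#
  mon v (b ∷ A) = pick b (v zero) * mon (v ∘ suc) A

  ∑ : List Carrier → Carrier
  ∑ = foldr _+_ 0#

  ∑-++ : ∀ xs ys → ∑ (xs ++ ys) ≈ ∑ xs + ∑ ys
  ∑-++ []       ys = ≈-sym (+-identityˡ _)
  ∑-++ (x ∷ xs) ys = ≈-trans (+-congˡ (∑-++ xs ys)) (≈-sym (+-assoc _ _ _))

  -- Takes an arbitrary list of subsets, so that the two halves of `allSubsets (suc m)` can be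
  -- treated separately, each by induction on its list.
  sumOver : ∀ {m} → ℕ → (Fin m → Carrier) → List (Subset m) → Carrier
  sumOver d v As = ∑ (map (mon v) (filter (λ A → ∣ A ∣ ≟ d) As))

  elem : ∀ m → ℕ → (Fin m → Carrier) → Carrier
  elem m d v = sumOver d v (allSubsets m)

  sumOver-true : ∀ {m} d (v : Fin (suc m) → Carrier) As →
    sumOver (suc d) v (map (true ∷_) As) ≈ v zero * sumOver d (v ∘ suc) As
  sumOver-true d v []       = ≈-sym (zeroʳ _)
  sumOver-true d v (A ∷ As) with ∣ A ∣ ≡ᵇ d
  -- Both filters decide by the same Boolean: `suc ∣ A ∣ ≡ᵇ suc d` computes to `∣ A ∣ ≡ᵇ d`.
  ... | true  = ≈-trans (+-congˡ (sumOver-true d v As)) (≈-sym (distribˡ _ _ _))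
  ... | false = sumOver-true d v As

  sumOver-false : ∀ {m} d (v : Fin (suc m) → Carrier) As →
    sumOver d v (map (false ∷_) As) ≈ sumOver d (v ∘ suc) As
  sumOver-false d v []       = ≈-refl
  sumOver-false d v (A ∷ As) with ∣ A ∣ ≡ᵇ d
  ... | true  = +-cong (*-identityˡ _) (sumOver-false d v As)
  ... | false = sumOver-false d v As

  -- Pascal's recursion: the subsets that contain the first variable contribute the first term, the
  -- others the second.
  elem-suc : ∀ m d (v : Fin (suc m) → Carrier) →
    elem (suc m) (suc d) v ≈ v zero * elem m d (v ∘ suc) + elem m (suc d) (v ∘ suc)
  elem-suc m d v = begin
    sumOver (suc d) v (ts ++ fs)
      ≡⟨ ≡.cong (∑ ∘ map (mon v)) (List.filter-++ (λ A → ∣ A ∣ ≟ suc d) ts fs) ⟩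
    ∑ (map (mon v) (filter _ ts ++ filter _ fs))
      ≡⟨ ≡.cong ∑ (List.map-++ (mon v) (filter _ ts) (filter _ fs)) ⟩
    ∑ (map (mon v) (filter _ ts) ++ map (mon v) (filter _ fs))
      ≈⟨ ∑-++ (map (mon v) (filter _ ts)) _ ⟩
    sumOver (suc d) v ts + sumOver (suc d) v fs
      ≈⟨ +-cong (sumOver-true d v (allSubsets m)) (sumOver-false (suc d) v (allSubsets m)) ⟩
    v zero * elem m d (v ∘ suc) + elem m (suc d) (v ∘ suc) ∎
    where
    ts = map (true ∷_) (allSubsets m)
    fs = map (false ∷_) (allSubsets m)

  elem-> : ∀ m d (v : Fin m → Carrier) → m < d → elem m d v ≈ 0#
  elem-> zero    (suc d) v _         = ≈-refl
  elem-> (suc m) (suc d) v (s≤s m<d) = begin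
    elem (suc m) (suc d) v ≈⟨ elem-suc m d v ⟩
    v zero * elem m d (v ∘ suc) + elem m (suc d) (v ∘ suc)
      ≈⟨ +-cong (*-congˡ (elem-> m d _ m<d)) (elem-> m (suc d) _ (ℕ.m<n⇒m<1+n m<d)) ⟩
    v zero * 0# + 0# ≈⟨ +-identityʳ _ ⟩
    v zero * 0# ≈⟨ zeroʳ _ ⟩
    0# ∎

  elem-∏ : ∀ m (v : Fin m → Carrier) → elem m m v ≈ ∏ (tabulate v)
  elem-∏ zero    v = +-identityʳ _
  elem-∏ (suc m) v = begin
    elem (suc m) (suc m) v ≈⟨ elem-suc m m v ⟩
    v zero * elem m m (v ∘ suc) + elem m (suc m) (v ∘ suc)
      ≈⟨ +-cong (*-congˡ (elem-∏ m _)) (elem-> m (suc m) _ ℕ.≤-refl) ⟩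
    ∏ (tabulate v) + 0# ≈⟨ +-identityʳ _ ⟩
    ∏ (tabulate v) ∎

  -- Pascal's recursion becomes the recursion of `σ` once the term of full degree is known to be the
  -- product of all values.
  elem-σ : ∀ m (v : Fin (suc m) → Carrier) → elem (suc m) m v ≈ σ (tabulate v)
  elem-σ zero    v = +-cong (*-identityˡ _) (≈-sym (zeroʳ _))
  elem-σ (suc m) v = begin
    elem (suc (suc m)) (suc m) v ≈⟨ elem-suc (suc m) m v ⟩
    v zero * elem (suc m) m (v ∘ suc) + elem (suc m) (suc m) (v ∘ suc)
      ≈⟨ +-cong (*-congˡ (elem-σ m _)) (elem-∏ (suc m) _) ⟩
    v zero * σ (tabulate (v ∘ suc)) + ∏ (tabulate (v ∘ suc)) ≈⟨ +-comm _ _ ⟩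
    σ (tabulate v) ∎

-- The polynomial ring, and `esym` in the form of `σ`.

module ReadOnceSums {c ℓ : Level} (F : Field c ℓ) where
  open Poly F
  private module F = Field F

  -- Lets the identities for symmetric sums serve twice: for polynomials here, and for values in `F`
  -- in the lower bound.
  exprRing : ℕ → CommutativeRing c (c ⊔ ℓ)
  exprRing n = record
    { Carrier = Expr n
    ; _≈_ = _≋_
    ; _+_ = _+_
    ; _*_ = _*_
    ; -_ = neg
    ; 0# = const F.0#
    ; 1# = const F.1#
    ; isCommutativeRing = record
      { isRing = record
        { +-isAbelianGroup = record
          { isGroup = record
            { isMonoid = record
              { isSemigroup = record
                { isMagma = record
                  { isEquivalence = record { refl = ≋-refl ; sym = ≋-sym ; trans = ≋-trans }
                  ; ∙-cong = +-cong }
                ; assoc = +-assoc }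
              ; identity = +-identityˡ , λ p → ≋-trans (+-comm _ _) (+-identityˡ p) }
            ; inverse = -‿inverseˡ , λ p → ≋-trans (+-comm _ _) (-‿inverseˡ p)
            ; ⁻¹-cong = neg-cong }
          ; comm = +-comm }
        ; *-cong = *-cong
        ; *-assoc = *-assoc
        ; *-identity = *-identityˡ , λ p → ≋-trans (*-comm _ _) (*-identityˡ p)
        ; distrib = distribˡ , λ p q r →
            ≋-trans (*-comm _ _) (≋-trans (distribˡ p q r) (+-cong (*-comm _ _) (*-comm _ _)))
        }
      ; *-comm = *-comm
      }
    }

  module _ {n : ℕ} where
    open SymmetricSums (exprRing n) public

  module _ {n : ℕ} (A : Subset n) where

    -- The body of monomial applies a private local function; unification recovers it.
    private
      factors : Σ (Fin n → Expr n) λ g →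
        monomial A ≡ Vec.foldr _ _*_ (const F.1#) (Vec.map g (Vec.allFin n))
      factors = _ , ≡.refl

    factors-pick : ∀ i → proj₁ factors i ≡ pick (Vec.lookup A i) (var i)
    factors-pick i with Vec.lookup A i
    ... | true  = ≡.refl
    ... | false = ≡.refl

    -- Stated for any `v` in place of `var`, since the induction replaces `v` by `v ∘ suc`.
    mon-foldr : ∀ {m} (v : Fin m → Expr n) (B : Subset m) →
      Vec.foldr _ _*_ (const F.1#) (Vec.tabulate λ i → pick (Vec.lookup B i) (v i)) ≡ mon v B
    mon-foldr v []      = ≡.refl
    mon-foldr v (b ∷ B) = ≡.cong (pick b (v zero) *_) (mon-foldr (v ∘ suc) B)

    monomial-mon : monomial A ≡ mon var A
    monomial-mon = begin
      monomial A ≡⟨ proj₂ factors ⟩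
      foldr* (Vec.map (proj₁ factors) (Vec.allFin n))
        ≡⟨ ≡.cong foldr* (Vec.map-cong factors-pick (Vec.allFin n)) ⟩
      foldr* (Vec.map (λ i → pick (Vec.lookup A i) (var i)) (Vec.allFin n))
        ≡⟨ ≡.cong foldr* (Vec.tabulate-∘ _ id) ⟨
      foldr* (Vec.tabulate λ i → pick (Vec.lookup A i) (var i)) ≡⟨ mon-foldr var A ⟩
      mon var A ∎
      where
      open ≡.≡-Reasoning
      foldr* = Vec.foldr (λ _ → Expr n) _*_ (const F.1#)

  -- For `n = 0` this would fail: `esym 0 0` is 1, whereas `σ []` is 0.
  esym-σ : ∀ n → 1 ≤ n → esym n (n ∸ 1) ≋ σ (map var (allFin n))
  esym-σ (suc m) (s≤s z≤n) = begin
    esym (suc m) m ≡⟨ ≡.cong (foldr _+_ (const F.0#)) 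
           (List.map-cong monomial-mon (filter (λ A → ∣ A ∣ ≟ m) (allSubsets (suc m)))) ⟩
    elem (suc m) m var ≈⟨ elem-σ m var ⟩
    σ (tabulate var) ≡⟨ ≡.cong σ (List.map-tabulate id var) ⟨
    σ (map var (allFin (suc m))) ∎
    where open import Relation.Binary.Reasoning.Setoid (CommutativeRing.setoid (exprRing (suc m)))

  -- Upper bound: one read-once summand for each pair of variables.

  module Upper (n : ℕ) where
    open CommutativeRing (exprRing n)
      using (setoid; commutativeSemiring; +-identityʳ; *-identityʳ; zeroʳ; +-congʳ; +-congˡ; *-congˡ)
    open SemiringSolver commutativeSemiring using (solve; _:=_; _:+_; _:*_)
    open import Relation.Binary.Reasoning.Setoid setoid

    ∏var : List (Fin n) → Expr n
    ∏var L = ∏ (map var L)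

    1·_+0 : ∀ p → const F.1# * p + const F.0# ≋ p
    1· p +0 = ≋-trans (+-identityʳ _) (*-identityˡ p)

    -- A formula has at least one leaf, so the list of factors comes with a separate head; the empty
    -- product is covered by the constants among the ROPs.
    productROF : Fin n → List (Fin n) → ROF n
    productROF i []      = leaf i F.1# F.0#
    productROF i (j ∷ L) = node times (leaf i F.1# F.0#) (productROF j L) F.1# F.0#

    leaves-productROF : ∀ i L → leaves (productROF i L) ≡ i ∷ L
    leaves-productROF i []      = ≡.refl
    leaves-productROF i (j ∷ L) = ≡.cong (i ∷_) (leaves-productROF j L)

    ⟦productROF⟧ : ∀ i L → ∏var (i ∷ L) ≋ ⟦ productROF i L ⟧
    ⟦productROF⟧ i []      = ≋-trans (*-identityʳ _) (≋-sym 1· _ +0)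
    ⟦productROF⟧ i (j ∷ L) = ≋-sym
      (≋-trans 1· _ +0 (*-cong 1· _ +0 (≋-sym (⟦productROF⟧ j L))))

    product-isROP : ∀ L → Unique L → IsROP (∏var L)
    product-isROP []      _ = inj₁ (F.1# , ≋-refl)
    product-isROP (i ∷ L) u = inj₂ (productROF i L ,
      subst Unique (≡.sym (leaves-productROF i L)) u , ⟦productROF⟧ i L)

    pairROF : Fin n → Fin n → ROF n
    pairROF i j = node plus (leaf i F.1# F.0#) (leaf j F.1# F.0#) F.1# F.0#

    ⟦pairROF⟧ : ∀ i j → ⟦ pairROF i j ⟧ ≋ var i + var j
    ⟦pairROF⟧ i j = ≋-trans 1· _ +0 (+-cong 1· _ +0 1· _ +0)

    pair-isROP : ∀ i j L → Unique (i ∷ j ∷ L) → IsROP ((var i + var j) * ∏var L)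
    pair-isROP i j []      u = inj₂ (pairROF i j , u ,
      ≋-trans (*-identityʳ _) (≋-sym (⟦pairROF⟧ i j)))
    pair-isROP i j (k ∷ L) u = inj₂
      ( node times (pairROF i j) (productROF k L) F.1# F.0#
      , subst Unique (≡.sym (≡.cong (λ l → i ∷ j ∷ l) (leaves-productROF k L))) u
      , ≋-sym (≋-trans 1· _ +0 (*-cong (⟦pairROF⟧ i j) (≋-sym (⟦productROF⟧ k L)))))

    -- The variables of P have already been treated in pairs: summands are multiplied by ∏var P.
    summands : (P L : List (Fin n)) → Vec (Expr n) ⌈ length L /2⌉
    summands P []          = []
    summands P (i ∷ [])    = ∏var P ∷ []
    summands P (i ∷ j ∷ L) = (var i + var j) * ∏var (P ++ L) ∷ summands (i ∷ j ∷ P) L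

    -- Each summand uses treated and untreated variables together, so the invariant is that all of
    -- `P ++ L` are distinct. Moving `i` and `j` from `L` to `P` only permutes them.
    summands-isROP : ∀ P L → Unique (P ++ L) → All IsROP (summands P L)
    summands-isROP P []          u = []
    summands-isROP P (i ∷ [])    u with Unique-resp-↭ (shift i P []) u
    ... | _ ∷ u′ = product-isROP P (subst Unique (List.++-identityʳ P) u′) ∷ []
    summands-isROP P (i ∷ j ∷ L) u = pair-isROP i j (P ++ L) u′ ∷ summands-isROP (i ∷ j ∷ P) L u′
      where
      u′ : Unique (i ∷ j ∷ P ++ L)
      u′ = Unique-resp-↭ (trans (shift i P (j ∷ L)) (prep i (shift j P L))) u

    -- Induction on `L`, two variables at a time: after multiplication by `∏var P`, the remainder
    -- `xᵢ xⱼ S_L` is the same statement for `i ∷ j ∷ P`.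
    sum-summands : ∀ P L → ∏var P * σ (map var L) ≋ sumE (summands P L)
    sum-summands P []          = zeroʳ _
    sum-summands P (i ∷ [])    = begin
      -- With one variable left over, `σ` is 1, and the last summand is `∏var P` alone.
      ∏var P * (const F.1# + var i * const F.0#) ≈⟨ *-congˡ (+-congˡ (zeroʳ _)) ⟩
      ∏var P * (const F.1# + const F.0#) ≈⟨ *-congˡ (+-identityʳ _) ⟩
      ∏var P * const F.1# ≈⟨ *-identityʳ _ ⟩
      ∏var P ≈⟨ +-identityʳ _ ⟨
      ∏var P + const F.0# ∎
    sum-summands P (i ∷ j ∷ L) = begin
      ∏var P * (var j * ∏var L + var i * (∏var L + var j * σ (map var L)))
        ≈⟨ solve 5 (λ p x y z s → p :* (y :* z :+ x :* (z :+ y :* s))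
                               := (x :+ y) :* (p :* z) :+ (x :* (y :* p)) :* s)
             ≋-refl (∏var P) (var i) (var j) _ _ ⟩
      (var i + var j) * (∏var P * ∏var L) + ∏var (i ∷ j ∷ P) * σ (map var L)
        ≈⟨ +-cong (*-congˡ (∏-++ (map var P) _)) (≋-sym (sum-summands (i ∷ j ∷ P) L)) ⟨
      (var i + var j) * ∏ (map var P ++ map var L) + sumE (summands (i ∷ j ∷ P) L)
        ≡⟨ ≡.cong (λ Q → (var i + var j) * ∏ Q + sumE (summands (i ∷ j ∷ P) L))
             (List.map-++ var P L) ⟨
      (var i + var j) * ∏var (P ++ L) + sumE (summands (i ∷ j ∷ P) L) ∎

  upper-bound : ∀ n → 1 ≤ n →
    Σ (Vec (Expr n) ⌈ n /2⌉) (λ ps → All IsROP ps × (esym n (n ∸ 1) ≋ sumE ps))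
  upper-bound n 1≤n = subst
    (λ k → Σ (Vec (Expr n) ⌈ k /2⌉) (λ ps → All IsROP ps × (esym n (n ∸ 1) ≋ sumE ps)))
    (List.length-tabulate id)
    ( summands [] (allFin n)
    , summands-isROP [] (allFin n) (allFin⁺ n)
    , ≋-trans (esym-σ n 1≤n)
        (≋-trans (≋-sym (*-identityˡ _)) (sum-summands [] (allFin n))))
    where open Upper n

Unique-++⁻ : ∀ {a} {A : Set a} (xs : List A) {ys} → Unique (xs ++ ys) →
  Unique xs × Unique ys × (∀ {x} → x ∈ xs → x ∉ ys)
Unique-++⁻ []       u       = [] , u , λ ()
Unique-++⁻ (x ∷ xs) (x∉ ∷ u) with uxs , uys , disj ← Unique-++⁻ xs u =
  ++⁻ˡ xs x∉ ∷ uxs , uys ,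
  λ { (here ≡.refl) → All¬⇒¬Any (++⁻ʳ xs x∉) ; (there x∈) → disj x∈ }

∈-↭ : ∀ {a} {A : Set a} {x : A} {xs} → x ∈ xs → ∃ λ ys → xs ↭ x ∷ ys
∈-↭ {x = x} x∈xs with ys , zs , ≡.refl ← ∈-∃++ x∈xs = ys ++ zs , shift x ys zs

-- Lower bound: values of polynomials.

module LowerBound {c ℓ : Level} (F : Field c ℓ) (n : ℕ) where
  open Field F hiding (zero) renaming (refl to ≈-refl; trans to ≈-trans; sym to ≈-sym)
  open RingProperties ring using (-‿distribˡ-*; -‿distribʳ-*; -‿+-comm)
  open SemiringSolver commutativeSemiring using (solve; _:=_; _:+_; _:*_)
  open import Relation.Binary.Reasoning.Setoid setoid
  open SymmetricSums commutativeRing using (∏; σ; ∏-↭; σ-↭)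
  private module P = Poly F
  open P using (Expr; var; const; neg; _≋_; ROF; leaf; node; plus; times; ReadOnce; leaves; ⟦_⟧; IsROP; sumE)
    renaming (_+_ to _⊕_; _*_ to _⊗_)

  sub-self : ∀ {x y} → x ≈ y → x - y ≈ 0#
  sub-self {x} {y} x≈y = ≈-trans (+-congʳ x≈y) (-‿inverseʳ y)

  sub-cong : ∀ {x x′ y y′} → x ≈ x′ → y ≈ y′ → x - y ≈ x′ - y′
  sub-cong p q = +-cong p (-‿cong q)

  sub-+ : ∀ a b c d → (a + b) - (c + d) ≈ (a - c) + (b - d)
  sub-+ a b c d = ≈-trans (+-congˡ (≈-sym (-‿+-comm c d)))
    (solve 4 (λ a b c d → (a :+ b) :+ (c :+ d) := (a :+ c) :+ (b :+ d)) ≈-refl a b (- c) (- d))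

  sub-*ʳ : ∀ a b r → a * r - b * r ≈ (a - b) * r
  sub-*ʳ a b r = ≈-trans (+-congˡ (-‿distribˡ-* b r)) (≈-sym (distribʳ r a (- b)))

  sub-*ˡ : ∀ r a b → r * a - r * b ≈ r * (a - b)
  sub-*ˡ r a b = ≈-trans (+-congˡ (-‿distribʳ-* r b)) (≈-sym (distribˡ r a (- b)))

  add-sub : ∀ a b → (a + b) - b ≈ a
  add-sub a b = ≈-trans (+-assoc a b (- b)) (≈-trans (+-congˡ (-‿inverseʳ b)) (+-identityʳ a))

  Env : Set c
  Env = Fin n → Carrier

  eval : Expr n → Env → Carrier
  eval (var i)   ρ = ρ i
  eval (const a) ρ = a
  eval (p ⊕ q)   ρ = eval p ρ + eval q ρ
  eval (p ⊗ q)   ρ = eval p ρ * eval q ρ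
  eval (neg p)   ρ = - eval p ρ

  -- The passage from polynomial identities to values: every axiom of the free algebra holds in `F`
  -- under every environment.
  eval-≋ : ∀ {p q} → p ≋ q → ∀ ρ → eval p ρ ≈ eval q ρ
  eval-≋ P.≋-refl            ρ = ≈-refl
  eval-≋ (P.≋-sym p)         ρ = ≈-sym (eval-≋ p ρ)
  eval-≋ (P.≋-trans p q)     ρ = ≈-trans (eval-≋ p ρ) (eval-≋ q ρ)
  eval-≋ (P.+-cong p q)      ρ = +-cong (eval-≋ p ρ) (eval-≋ q ρ)
  eval-≋ (P.*-cong p q)      ρ = *-cong (eval-≋ p ρ) (eval-≋ q ρ)
  eval-≋ (P.neg-cong p)      ρ = -‿cong (eval-≋ p ρ)
  eval-≋ (P.+-assoc p q r)   ρ = +-assoc _ _ _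
  eval-≋ (P.+-comm p q)      ρ = +-comm _ _
  eval-≋ (P.+-identityˡ p)   ρ = +-identityˡ _
  eval-≋ (P.-‿inverseˡ p)    ρ = -‿inverseˡ _
  eval-≋ (P.*-assoc p q r)   ρ = *-assoc _ _ _
  eval-≋ (P.*-comm p q)      ρ = *-comm _ _
  eval-≋ (P.*-identityˡ p)   ρ = *-identityˡ _
  eval-≋ (P.distribˡ p q r)  ρ = distribˡ _ _ _
  eval-≋ (P.const-cong a≈b)  ρ = a≈b
  eval-≋ (P.const-+ a b)     ρ = ≈-refl
  eval-≋ (P.const-* a b)     ρ = ≈-refl

  infixl 8 _[_≔_]

  _[_≔_] : Env → Fin n → Carrier → Env
  ρ [ i ≔ a ] = updateAt ρ i (K a)

  ≔-same : ∀ ρ i a → (ρ [ i ≔ a ]) i ≡ a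
  ≔-same ρ i a = updateAt-updates i ρ

  ≔-other : ∀ ρ {i j} a → j ≢ i → (ρ [ i ≔ a ]) j ≡ ρ j
  ≔-other ρ {i} {j} a j≢i = updateAt-minimal j i ρ j≢i

  ≔-cong : ∀ {ρ ρ′ : Env} i a j → (j ≢ i → ρ j ≈ ρ′ j) → (ρ [ i ≔ a ]) j ≈ (ρ′ [ i ≔ a ]) j
  ≔-cong {ρ} {ρ′} i a j eq with j Fin.≟ i
  ... | yes ≡.refl = reflexive (≡.trans (≔-same ρ i a) (≡.sym (≔-same ρ′ i a)))
  ... | no  j≢i    = ≈-trans (reflexive (≔-other ρ a j≢i))
                       (≈-trans (eq j≢i) (reflexive (≡.sym (≔-other ρ′ a j≢i))))

  -- Occurrence of variables and difference operators.

  Occurs : Fin n → Expr n → Set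
  Occurs i (var j)   = i ≡ j
  Occurs i (const a) = ⊥
  Occurs i (p ⊕ q)   = Occurs i p ⊎ Occurs i q
  Occurs i (p ⊗ q)   = Occurs i p ⊎ Occurs i q
  Occurs i (neg p)   = Occurs i p

  -- Occurrence is syntactic and therefore decidable, whereas it need not be decidable whether the
  -- value really depends on a variable.
  occurs? : ∀ i e → Dec (Occurs i e)
  occurs? i (var j)   = i Fin.≟ j
  occurs? i (const a) = no id
  occurs? i (p ⊕ q)   = occurs? i p ⊎-dec occurs? i q
  occurs? i (p ⊗ q)   = occurs? i p ⊎-dec occurs? i q
  occurs? i (neg p)   = occurs? i p

  eval-agree : ∀ e {ρ ρ′} → (∀ {i} → Occurs i e → ρ i ≈ ρ′ i) → eval e ρ ≈ eval e ρ′
  eval-agree (var j)   eq = eq ≡.refl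
  eval-agree (const a) eq = ≈-refl
  eval-agree (p ⊕ q)   eq = +-cong (eval-agree p (eq ∘ inj₁)) (eval-agree q (eq ∘ inj₂))
  eval-agree (p ⊗ q)   eq = *-cong (eval-agree p (eq ∘ inj₁)) (eval-agree q (eq ∘ inj₂))
  eval-agree (neg p)   eq = -‿cong (eval-agree p eq)

  absent-≢ : ∀ {i j} e → ¬ Occurs i e → Occurs j e → j ≢ i
  absent-≢ e i∉e j∈e ≡.refl = i∉e j∈e

  eval-absent : ∀ e {i} → ¬ Occurs i e → ∀ ρ a → eval e (ρ [ i ≔ a ]) ≈ eval e ρ
  eval-absent e i∉e ρ a = eval-agree e λ j∈e → reflexive (≔-other ρ a (absent-≢ e i∉e j∈e))

  -- For multilinear f, D L f is the iterated partial derivative with respect to the variables in L.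
  D : List (Fin n) → (Env → Carrier) → Env → Carrier
  D []      f ρ = f ρ
  D (i ∷ L) f ρ = D L f (ρ [ i ≔ 1# ]) - D L f (ρ [ i ≔ 0# ])

  D-cong : ∀ L {f g : Env → Carrier} → (∀ ρ → f ρ ≈ g ρ) → ∀ ρ → D L f ρ ≈ D L g ρ
  D-cong []      eq ρ = eq ρ
  D-cong (i ∷ L) eq ρ = sub-cong (D-cong L eq _) (D-cong L eq _)

  D-+ : ∀ L f g ρ → D L (λ ρ → f ρ + g ρ) ρ ≈ D L f ρ + D L g ρ
  D-+ []      f g ρ = ≈-refl
  D-+ (i ∷ L) f g ρ = ≈-trans (sub-cong (D-+ L f g _) (D-+ L f g _)) (sub-+ _ _ _ _)

  D-0 : ∀ L ρ → D L (K 0#) ρ ≈ 0#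
  D-0 []      ρ = ≈-refl
  D-0 (i ∷ L) ρ = sub-self (≈-trans (D-0 L _) (≈-sym (D-0 L _)))

  D-agree : ∀ L e {ρ ρ′} → (∀ {i} → Occurs i e → ρ i ≈ ρ′ i) → D L (eval e) ρ ≈ D L (eval e) ρ′
  D-agree []      e eq = eval-agree e eq
  D-agree (i ∷ L) e eq = sub-cong
    (D-agree L e λ j∈e → ≔-cong i 1# _ (K (eq j∈e)))
    (D-agree L e λ j∈e → ≔-cong i 0# _ (K (eq j∈e)))

  D-absent-≔ : ∀ L e {i} → ¬ Occurs i e → ∀ ρ a → D L (eval e) (ρ [ i ≔ a ]) ≈ D L (eval e) ρ
  D-absent-≔ L e i∉e ρ a =
    D-agree L e λ j∈e → reflexive (≔-other ρ a (absent-≢ e i∉e j∈e))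

  D-absent : ∀ {L i} e → i ∈ L → ¬ Occurs i e → ∀ ρ → D L (eval e) ρ ≈ 0#
  D-absent {L = _ ∷ L} e (here ≡.refl) i∉e ρ =
    sub-self (≈-trans (D-absent-≔ L e i∉e ρ 1#) (≈-sym (D-absent-≔ L e i∉e ρ 0#)))
  D-absent {L = _ ∷ L} e (there i∈L)   i∉e ρ =
    sub-self (≈-trans (D-absent e i∈L i∉e _) (≈-sym (D-absent e i∈L i∉e _)))

  -- Each variable of `L` is absent from one of the factors, so that factor is a constant for the
  -- difference in this variable and can be pulled out.
  D-⊗ : ∀ {L₁ L₂ L} p q → Interleaving L₁ L₂ L →
    (∀ {i} → i ∈ L₁ → ¬ Occurs i q) → (∀ {i} → i ∈ L₂ → ¬ Occurs i p) →
    ∀ ρ → D L (eval (p ⊗ q)) ρ ≈ D L₁ (eval p) ρ * D L₂ (eval q) ρ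
  D-⊗ p q [] _ _ ρ = ≈-refl
  D-⊗ {i ∷ L₁} {L₂} {i ∷ L} p q (consˡ s) ∉q ∉p ρ = ≈-trans
    (sub-cong (step 1#) (step 0#)) (sub-*ʳ _ _ _)
    where
    step : ∀ a → D L (eval (p ⊗ q)) (ρ [ i ≔ a ])
               ≈ D L₁ (eval p) (ρ [ i ≔ a ]) * D L₂ (eval q) ρ
    step a = ≈-trans (D-⊗ p q s (∉q ∘ there) ∉p _)
      (*-congˡ (D-absent-≔ L₂ q (∉q (here ≡.refl)) ρ a))
  D-⊗ {L₁} {i ∷ L₂} {i ∷ L} p q (consʳ s) ∉q ∉p ρ = ≈-trans
    (sub-cong (step 1#) (step 0#)) (sub-*ˡ _ _ _)
    where
    step : ∀ a → D L (eval (p ⊗ q)) (ρ [ i ≔ a ])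
               ≈ D L₁ (eval p) ρ * D L₂ (eval q) (ρ [ i ≔ a ])
    step a = ≈-trans (D-⊗ p q s ∉q (∉p ∘ there) _)
      (*-congʳ (D-absent-≔ L₁ p (∉p (here ≡.refl)) ρ a))

  -- Read-once expressions: restriction and formal differentiation.

  data RO : Expr n → Set c where
    var   : ∀ i → RO (var i)
    const : ∀ a → RO (const a)
    add   : ∀ {p q} → RO p → RO q → (∀ {i} → Occurs i p → ¬ Occurs i q) → RO (p ⊕ q)
    mul   : ∀ {p q} → RO p → RO q → (∀ {i} → Occurs i p → ¬ Occurs i q) → RO (p ⊗ q)

  occurs-leaves : ∀ {i} t → Occurs i ⟦ t ⟧ → i ∈ leaves t
  occurs-leaves (leaf j α β) (inj₁ (inj₂ ≡.refl)) = here ≡.refl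
  occurs-leaves (node plus  l r α β) (inj₁ (inj₂ (inj₁ o))) = ∈-++⁺ˡ (occurs-leaves l o)
  occurs-leaves (node plus  l r α β) (inj₁ (inj₂ (inj₂ o))) = ∈-++⁺ʳ (leaves l) (occurs-leaves r o)
  occurs-leaves (node times l r α β) (inj₁ (inj₂ (inj₁ o))) = ∈-++⁺ˡ (occurs-leaves l o)
  occurs-leaves (node times l r α β) (inj₁ (inj₂ (inj₂ o))) = ∈-++⁺ʳ (leaves l) (occurs-leaves r o)

  RO-affine : ∀ {e} α β → RO e → RO (const α ⊗ e ⊕ const β)
  RO-affine α β r = add (mul (const α) r λ ()) (const β) λ _ ()

  -- Distinct leaves give disjoint variables at every gate. This local condition allows constant
  -- leaves and is stable under `restrict` and `∂`.
  readOnce⇒RO : ∀ t → ReadOnce t → RO ⟦ t ⟧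
  readOnce⇒RO (leaf i α β) u = RO-affine α β (var i)
  readOnce⇒RO (node plus l r α β) u with ul , ur , disj ← Unique-++⁻ (leaves l) u =
    RO-affine α β (add (readOnce⇒RO l ul) (readOnce⇒RO r ur)
      λ i∈l i∈r → disj (occurs-leaves l i∈l) (occurs-leaves r i∈r))
  readOnce⇒RO (node times l r α β) u with ul , ur , disj ← Unique-++⁻ (leaves l) u =
    RO-affine α β (mul (readOnce⇒RO l ul) (readOnce⇒RO r ur)
      λ i∈l i∈r → disj (occurs-leaves l i∈l) (occurs-leaves r i∈r))

  isROP⇒RO : ∀ {p} → IsROP p → ∃ λ e → RO e × p ≋ e
  isROP⇒RO (inj₁ (a , p≋a))       = const a , const a , p≋a
  isROP⇒RO (inj₂ (t , u , p≋t)) = ⟦ t ⟧ , readOnce⇒RO t u , p≋t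

  restrict : Fin n → Carrier → Expr n → Expr n
  restrict i a (var j) with i Fin.≟ j
  ... | yes _ = const a
  ... | no  _ = var j
  restrict i a (const b) = const b
  restrict i a (p ⊕ q)   = restrict i a p ⊕ restrict i a q
  restrict i a (p ⊗ q)   = restrict i a p ⊗ restrict i a q
  restrict i a (neg p)   = neg (restrict i a p)

  eval-restrict : ∀ i a e ρ → eval (restrict i a e) ρ ≈ eval e (ρ [ i ≔ a ])
  eval-restrict i a (var j) ρ with i Fin.≟ j
  ... | yes ≡.refl = reflexive (≡.sym (≔-same ρ i a))
  ... | no  i≢j    = reflexive (≡.sym (≔-other ρ a (i≢j ∘ ≡.sym)))
  eval-restrict i a (const b) ρ = ≈-refl
  eval-restrict i a (p ⊕ q)   ρ = +-cong (eval-restrict i a p ρ) (eval-restrict i a q ρ)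
  eval-restrict i a (p ⊗ q)   ρ = *-cong (eval-restrict i a p ρ) (eval-restrict i a q ρ)
  eval-restrict i a (neg p)   ρ = -‿cong (eval-restrict i a p ρ)

  occurs-restrict : ∀ {i a j} e → Occurs j (restrict i a e) → Occurs j e × j ≢ i
  occurs-restrict {i} (var k) o with i Fin.≟ k
  occurs-restrict {i} (var k) () | yes _
  ... | no i≢k = o , λ j≡i → i≢k (≡.trans (≡.sym j≡i) o)
  occurs-restrict (p ⊕ q) (inj₁ o) with o′ , ≢ ← occurs-restrict p o = inj₁ o′ , ≢
  occurs-restrict (p ⊕ q) (inj₂ o) with o′ , ≢ ← occurs-restrict q o = inj₂ o′ , ≢
  occurs-restrict (p ⊗ q) (inj₁ o) with o′ , ≢ ← occurs-restrict p o = inj₁ o′ , ≢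
  occurs-restrict (p ⊗ q) (inj₂ o) with o′ , ≢ ← occurs-restrict q o = inj₂ o′ , ≢
  occurs-restrict (neg p) o = occurs-restrict p o

  RO-restrict : ∀ {e} i a → RO e → RO (restrict i a e)
  RO-restrict i a (var j) with i Fin.≟ j
  ... | yes _ = const a
  ... | no  _ = var j
  RO-restrict i a (const b) = const b
  RO-restrict i a (add {p} {q} r s disj) = add (RO-restrict i a r) (RO-restrict i a s)
    λ o o′ → disj (proj₁ (occurs-restrict p o)) (proj₁ (occurs-restrict q o′))
  RO-restrict i a (mul {p} {q} r s disj) = mul (RO-restrict i a r) (RO-restrict i a s)
    λ o o′ → disj (proj₁ (occurs-restrict p o)) (proj₁ (occurs-restrict q o′))

  -- The product rule is that of factors without common variables: ∂ is correct on read-once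
  -- expressions only.
  ∂ : Fin n → Expr n → Expr n
  ∂ i (var j) with i Fin.≟ j
  ... | yes _ = const 1#
  ... | no  _ = const 0#
  ∂ i (const a) = const 0#
  ∂ i (p ⊕ q)   = ∂ i p ⊕ ∂ i q
  ∂ i (p ⊗ q) with occurs? i p
  ... | yes _ = ∂ i p ⊗ q
  ... | no  _ = p ⊗ ∂ i q
  ∂ i (neg p)   = neg (∂ i p)

  -- The variable `i` occurs at most once, so differentiation removes it; at a product, disjointness
  -- keeps it out of the other factor.
  occurs-∂ : ∀ {i j e} → RO e → Occurs j (∂ i e) → Occurs j e × j ≢ i
  occurs-∂ {i} (var k) o with i Fin.≟ k
  occurs-∂ {i} (var k) () | yes _
  occurs-∂ {i} (var k) () | no  _
  occurs-∂ (add r s disj) (inj₁ o) with o′ , ≢ ← occurs-∂ r o = inj₁ o′ , ≢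
  occurs-∂ (add r s disj) (inj₂ o) with o′ , ≢ ← occurs-∂ s o = inj₂ o′ , ≢
  occurs-∂ {i} (mul {p} {q} r s disj) o with occurs? i p
  occurs-∂ {i} (mul {p} {q} r s disj) (inj₁ o) | yes i∈p with o′ , ≢ ← occurs-∂ r o = inj₁ o′ , ≢
  occurs-∂ {i} (mul {p} {q} r s disj) (inj₂ o) | yes i∈p = inj₂ o , absent-≢ q (disj i∈p) o
  occurs-∂ {i} (mul {p} {q} r s disj) (inj₁ o) | no  i∉p = inj₁ o , absent-≢ p i∉p o
  occurs-∂ {i} (mul {p} {q} r s disj) (inj₂ o) | no  i∉p with o′ , ≢ ← occurs-∂ s o = inj₂ o′ , ≢

  RO-∂ : ∀ {e} i → RO e → RO (∂ i e)
  RO-∂ i (var j) with i Fin.≟ j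
  ... | yes _ = const 1#
  ... | no  _ = const 0#
  RO-∂ i (const a) = const 0#
  RO-∂ i (add r s disj) = add (RO-∂ i r) (RO-∂ i s)
    λ o o′ → disj (proj₁ (occurs-∂ r o)) (proj₁ (occurs-∂ s o′))
  RO-∂ i (mul {p} r s disj) with occurs? i p
  ... | yes _ = mul (RO-∂ i r) s λ o → disj (proj₁ (occurs-∂ r o))
  ... | no  _ = mul r (RO-∂ i s) λ o o′ → disj o (proj₁ (occurs-∂ s o′))

  -- Read-once expressions are affine in each variable, with slope `∂ i e`: at a product, one factor
  -- does not contain `i` and acts as a constant.
  eval-affine : ∀ {e} i → RO e → ∀ ρ a →
    eval e (ρ [ i ≔ a ]) ≈ eval e (ρ [ i ≔ 0# ]) + a * eval (∂ i e) ρ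
  eval-affine i (var j) ρ a with i Fin.≟ j
  ... | yes ≡.refl = begin
    (ρ [ i ≔ a ]) i             ≡⟨ ≔-same ρ i a ⟩
    a                           ≈⟨ *-identityʳ a ⟨
    a * 1#                      ≈⟨ +-identityˡ _ ⟨
    0# + a * 1#                 ≡⟨ ≡.cong (_+ a * 1#) (≔-same ρ i 0#) ⟨
    (ρ [ i ≔ 0# ]) i + a * 1#   ∎
  ... | no i≢j = begin
    (ρ [ i ≔ a ]) j             ≡⟨ ≔-other ρ a (i≢j ∘ ≡.sym) ⟩
    ρ j                         ≡⟨ ≔-other ρ 0# (i≢j ∘ ≡.sym) ⟨
    (ρ [ i ≔ 0# ]) j            ≈⟨ +-identityʳ _ ⟨
    (ρ [ i ≔ 0# ]) j + 0#       ≈⟨ +-congˡ (zeroʳ a) ⟨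
    (ρ [ i ≔ 0# ]) j + a * 0#   ∎
  eval-affine i (const b) ρ a = ≈-sym (≈-trans (+-congˡ (zeroʳ a)) (+-identityʳ b))
  eval-affine i (add r s _) ρ a = ≈-trans (+-cong (eval-affine i r ρ a) (eval-affine i s ρ a))
    (solve 5 (λ u v a x y → (u :+ a :* x) :+ (v :+ a :* y) := (u :+ v) :+ a :* (x :+ y))
      ≈-refl _ _ a _ _)
  eval-affine i (mul {p} {q} r s disj) ρ a with occurs? i p
  ... | yes i∈p = begin
    eval p (ρ [ i ≔ a ]) * eval q (ρ [ i ≔ a ])
      ≈⟨ *-cong (eval-affine i r ρ a) (eval-absent q (disj i∈p) ρ a) ⟩
    (eval p (ρ [ i ≔ 0# ]) + a * eval (∂ i p) ρ) * eval q ρ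
      ≈⟨ solve 4 (λ u a x v → (u :+ a :* x) :* v := u :* v :+ a :* (x :* v)) ≈-refl _ a _ _ ⟩
    eval p (ρ [ i ≔ 0# ]) * eval q ρ + a * (eval (∂ i p) ρ * eval q ρ)
      ≈⟨ +-congʳ (*-congˡ (eval-absent q (disj i∈p) ρ 0#)) ⟨
    eval p (ρ [ i ≔ 0# ]) * eval q (ρ [ i ≔ 0# ]) + a * (eval (∂ i p) ρ * eval q ρ) ∎
  ... | no i∉p = begin
    eval p (ρ [ i ≔ a ]) * eval q (ρ [ i ≔ a ])
      ≈⟨ *-cong (eval-absent p i∉p ρ a) (eval-affine i s ρ a) ⟩
    eval p ρ * (eval q (ρ [ i ≔ 0# ]) + a * eval (∂ i q) ρ)
      ≈⟨ solve 4 (λ v u a x → v :* (u :+ a :* x) := v :* u :+ a :* (v :* x)) ≈-refl _ _ a _ ⟩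
    eval p ρ * eval q (ρ [ i ≔ 0# ]) + a * (eval p ρ * eval (∂ i q) ρ)
      ≈⟨ +-congʳ (*-congʳ (eval-absent p i∉p ρ 0#)) ⟨
    eval p (ρ [ i ≔ 0# ]) * eval q (ρ [ i ≔ 0# ]) + a * (eval p ρ * eval (∂ i q) ρ) ∎

  eval-∂ : ∀ {e} i → RO e → ∀ ρ → eval (∂ i e) ρ ≈ D (i ∷ []) (eval e) ρ
  eval-∂ {e} i r ρ = ≈-sym (begin
    eval e (ρ [ i ≔ 1# ]) - eval e (ρ [ i ≔ 0# ])
      ≈⟨ +-congʳ (≈-trans (eval-affine i r ρ 1#) (+-comm _ _)) ⟩
    (1# * eval (∂ i e) ρ + eval e (ρ [ i ≔ 0# ])) - eval e (ρ [ i ≔ 0# ])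
      ≈⟨ add-sub _ _ ⟩
    1# * eval (∂ i e) ρ ≈⟨ *-identityˡ _ ⟩
    eval (∂ i e) ρ ∎)

  -- Expressions not annihilated by any reduction operation.

  *-nonzero : ∀ {x y} → ¬ (x ≈ 0#) → ¬ (y ≈ 0#) → ¬ (x * y ≈ 0#)
  *-nonzero {x} {y} x≉0 y≉0 xy≈0 with y⁻¹ , yy⁻¹≈1 ← inverse y y≉0 = x≉0 (begin
    x              ≈⟨ *-identityʳ x ⟨
    x * 1#         ≈⟨ *-congˡ yy⁻¹≈1 ⟨
    x * (y * y⁻¹)  ≈⟨ *-assoc x y y⁻¹ ⟨
    x * y * y⁻¹    ≈⟨ *-congʳ xy≈0 ⟩
    0# * y⁻¹       ≈⟨ zeroˡ y⁻¹ ⟩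
    0#             ∎)

  *-zeroˡ : ∀ {x y} → x ≈ 0# → x * y ≈ 0#
  *-zeroˡ x≈0 = ≈-trans (*-congʳ x≈0) (zeroˡ _)

  *-zeroʳ : ∀ {x y} → y ≈ 0# → x * y ≈ 0#
  *-zeroʳ y≈0 = ≈-trans (*-congˡ y≈0) (zeroʳ _)

  -- Not irreducibility with respect to factorisation: no operation of the reduction step
  -- annihilates `e`. Only occurring variables are considered, because `∂ᵢ∂ⱼ` trivially kills an
  -- expression without `xᵢ` or `xⱼ`.
  record Irreducible (e : Expr n) : Set (c ⊔ ℓ) where
    field
      ∂∂≉0 : ∀ {i j} → i ≢ j → Occurs i e → Occurs j e →
        ¬ (∀ ρ → D (i ∷ j ∷ []) (eval e) ρ ≈ 0#)
      ∂|≉0 : ∀ {i j a} → i ≢ j → Occurs i e → Occurs j e → ¬ (a ≈ 0#) →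
        ¬ (∀ ρ → D (i ∷ []) (eval e) (ρ [ j ≔ a ]) ≈ 0#)
  open Irreducible

  -- Both conditions follow from one statement because vanishing is transferred at each point:
  -- `∂ᵢ∂ⱼ` is the case of a singleton `L`, and a restricted `∂ᵢ` is the case of empty `L` at the
  -- point `ρ [ j ≔ a ]`.
  irreducible-transfer : ∀ {e e′} → (∀ {i} → Occurs i e′ → Occurs i e) →
    (∀ {i L} → ListAll (λ j → Occurs j e′) (i ∷ L) → ∀ ρ →
       D (i ∷ L) (eval e′) ρ ≈ 0# → D (i ∷ L) (eval e) ρ ≈ 0#) →
    Irreducible e → Irreducible e′
  irreducible-transfer sub vanish irr .∂∂≉0 i≢j i∈ j∈ h =
    irr .∂∂≉0 i≢j (sub i∈) (sub j∈) λ ρ → vanish (i∈ ∷ j∈ ∷ []) ρ (h ρ)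
  irreducible-transfer sub vanish irr .∂|≉0 i≢j i∈ j∈ a≉0 h =
    irr .∂|≉0 i≢j (sub i∈) (sub j∈) a≉0 λ ρ → vanish (i∈ ∷ []) _ (h ρ)

  Disjoint : Expr n → Expr n → Set
  Disjoint p q = ∀ {i} → Occurs i p → ¬ Occurs i q

  irreducible-summand : ∀ {p q} → Disjoint p q → Irreducible (p ⊕ q) → Irreducible p
  irreducible-summand {p} {q} disj = irreducible-transfer inj₁ λ {i} {L} i∈ ρ h → begin
    D (i ∷ L) (eval (p ⊕ q)) ρ ≈⟨ D-+ (i ∷ L) (eval p) (eval q) ρ ⟩
    D (i ∷ L) (eval p) ρ + D (i ∷ L) (eval q) ρ
      ≈⟨ +-cong h (D-absent {i ∷ L} q (here ≡.refl) (disj (ListAll.head i∈)) ρ) ⟩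
    0# + 0# ≈⟨ +-identityʳ 0# ⟩
    0# ∎

  -- For operations on variables of `p`, the factor `q` is carried along as a constant, so whatever
  -- kills `p` kills the product.
  irreducible-factor : ∀ {p q} → Disjoint p q → Irreducible (p ⊗ q) → Irreducible p
  irreducible-factor {p} {q} disj = irreducible-transfer inj₁ λ L⊆p ρ h →
    ≈-trans (D-⊗ p q (Interleaving.left (Pointwise.refl ≡.refl))
              (λ j∈L → disj (ListAll.lookup L⊆p j∈L)) (λ ()) ρ)
            (*-zeroˡ h)

  irreducible-≗ : ∀ {e e′} → (∀ ρ → eval e ρ ≈ eval e′ ρ) → (∀ {i} → Occurs i e′ → Occurs i e) →
    Irreducible e → Irreducible e′
  irreducible-≗ eq sub =
    irreducible-transfer sub λ {i} {L} _ ρ h → ≈-trans (D-cong (i ∷ L) eq ρ) h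

  -- Vanishing of the coefficient of the product of all variables except one.

  Within : List (Fin n) → Expr n → Set
  Within L e = ∀ {k} → Occurs k e → k ∈ L

  -- D L followed by xᵢ = 0 extracts from e the coefficient of the product of the variables in L.
  CoefficientVanishes : Fin n → Expr n → Set (c ⊔ ℓ)
  CoefficientVanishes i e = ∀ {j L} → j ∈ L → i ∉ L → Within (i ∷ L) e →
    ∀ ρ → ¬ ¬ (D L (eval e) (ρ [ i ≔ 0# ]) ≈ 0#)

  coefficient-≗ : ∀ {i e e′} → (∀ ρ → eval e ρ ≈ eval e′ ρ) → (∀ {i} → Occurs i e → Occurs i e′) →
    CoefficientVanishes i e → CoefficientVanishes i e′
  coefficient-≗ eq sub cv {L = L} j∈L i∉L within ρ h =
    cv j∈L i∉L (within ∘ sub) ρ (h ∘ ≈-trans (D-cong L (≈-sym ∘ eq) _))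

  -- If `q` contains a variable `k`, no monomial of the sum contains both `xᵢ` and `xₖ`, so `∂ᵢ∂ₖ`
  -- kills it, against irreducibility. Otherwise `q` is constant and is killed by the differences in
  -- the nonempty `L`.
  coefficient-⊕ : ∀ {i p q} → Disjoint p q → Irreducible (p ⊕ q) → Occurs i p →
    CoefficientVanishes i p → CoefficientVanishes i (p ⊕ q)
  coefficient-⊕ {i} {p} {q} disj irr i∈p cv {j} {L} j∈L i∉L within ρ with Fin.any? (λ k → occurs? k q)
  ... | yes (k , k∈q) = ⊥-elim (irr .∂∂≉0 {i} {k} (λ { ≡.refl → disj i∈p k∈q }) (inj₁ i∈p) (inj₂ k∈q)
          λ ρ → begin
            D (i ∷ k ∷ []) (eval (p ⊕ q)) ρ ≈⟨ D-+ (i ∷ k ∷ []) (eval p) (eval q) ρ ⟩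
            D (i ∷ k ∷ []) (eval p) ρ + D (i ∷ k ∷ []) (eval q) ρ
              ≈⟨ +-cong (D-absent {i ∷ k ∷ []} p (there (here ≡.refl)) (λ k∈p → disj k∈p k∈q) ρ)
                        (D-absent {i ∷ k ∷ []} q (here ≡.refl) (disj i∈p) ρ) ⟩
            0# + 0# ≈⟨ +-identityʳ 0# ⟩
            0# ∎)
  ... | no ∄k = λ h → cv j∈L i∉L (within ∘ inj₁) ρ λ p≈0 → h (begin
    D L (eval (p ⊕ q)) (ρ [ i ≔ 0# ]) ≈⟨ D-+ L (eval p) (eval q) _ ⟩
    D L (eval p) (ρ [ i ≔ 0# ]) + D L (eval q) (ρ [ i ≔ 0# ])
      ≈⟨ +-cong p≈0 (D-absent q j∈L (λ j∈q → ∄k (j , j∈q)) _) ⟩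
    0# + 0# ≈⟨ +-identityʳ 0# ⟩
    0# ∎)

  -- The variables of `L` are sorted by occurrence in `e`, in the interleaved form that `D-⊗` takes.
  record Split (e : Expr n) (L : List (Fin n)) : Set where
    field
      {L₁ L₂} : List (Fin n)
      interleaving : Interleaving L₁ L₂ L
      present : ∀ {k} → k ∈ L₁ → k ∈ L × Occurs k e
      absent  : ∀ {k} → k ∈ L₂ → ¬ Occurs k e
      cover   : ∀ {k} → k ∈ L → k ∈ L₁ ⊎ k ∈ L₂

  split : ∀ e L → Split e L
  split e [] = record
    { interleaving = [] ; present = λ () ; absent = λ () ; cover = λ () }
  split e (i ∷ L) with occurs? i e | split e L
  ... | yes i∈e | s = record
    { interleaving = consˡ interleaving
    ; present = λ { (here ≡.refl) → here ≡.refl , i∈e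
                  ; (there k∈) → there (proj₁ (present k∈)) , proj₂ (present k∈) }
    ; absent = absent
    ; cover = λ { (here ≡.refl) → inj₁ (here ≡.refl) ; (there k∈) → Sum.map₁ there (cover k∈) }
    } where open Split s
  ... | no i∉e | s = record
    { interleaving = consʳ interleaving
    ; present = λ k∈ → there (proj₁ (present k∈)) , proj₂ (present k∈)
    ; absent = λ { (here ≡.refl) → i∉e ; (there k∈) → absent k∈ }
    ; cover = λ { (here ≡.refl) → inj₂ (here ≡.refl) ; (there k∈) → Sum.map₂ there (cover k∈) }
    } where open Split s

  -- Suppose p = a xᵢ + b with b ≠ 0. Then a ≠ 0, or else ∂ᵢ∂ⱼ(p q) = 0; hence p, and with it
  -- ∂ⱼ(p q), vanishes at xᵢ = - b / a ≠ 0.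
  univariate-factor : ∀ {i j p q} → RO p → Disjoint p q → Irreducible (p ⊗ q) →
    Occurs i p → (∀ {k} → Occurs k p → k ≡ i) → Occurs j q →
    ∀ ρ → ¬ ¬ (eval p (ρ [ i ≔ 0# ]) ≈ 0#)
  univariate-factor {i} {j} {p} {q} ro disj irr i∈p only-i j∈q ρ b≉0 =
    irr .∂|≉0 (i≢j ∘ ≡.sym) (inj₂ j∈q) (inj₁ i∈p) γ≉0 λ ρ′ →
      ≈-trans (D-⊗ p q (consʳ []) (λ ()) (λ { (here ≡.refl) → j∉p }) (ρ′ [ i ≔ γ ])) (*-zeroˡ (root ρ′))
    where
    j∉p : ¬ Occurs j p
    j∉p j∈p = disj j∈p j∈q

    i≢j : i ≢ j
    i≢j ≡.refl = j∉p i∈p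

    a b : Carrier
    a = eval (∂ i p) ρ
    b = eval p (ρ [ i ≔ 0# ])

    -- As `i` is the only variable of `p`, slope and intercept are the same in every environment, so
    -- a single `γ` is a root in all of them.
    slope : ∀ ρ′ → eval (∂ i p) ρ′ ≈ a
    slope ρ′ = eval-agree (∂ i p) λ k∈ → let k∈p , k≢i = occurs-∂ ro k∈ in ⊥-elim (k≢i (only-i k∈p))

    intercept : ∀ ρ′ → eval p (ρ′ [ i ≔ 0# ]) ≈ b
    intercept ρ′ = eval-agree p λ k∈p → ≔-cong i 0# _ λ k≢i → ⊥-elim (k≢i (only-i k∈p))

    a≉0 : ¬ (a ≈ 0#)
    a≉0 a≈0 = irr .∂∂≉0 i≢j (inj₁ i∈p) (inj₂ j∈q) λ ρ′ → ≈-trans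
      (D-⊗ p q (consˡ (consʳ [])) (λ { (here ≡.refl) → disj i∈p }) (λ { (here ≡.refl) → j∉p }) ρ′)
      (*-zeroˡ (≈-trans (≈-sym (eval-∂ i ro ρ′)) (≈-trans (slope ρ′) a≈0)))

    a⁻¹ γ : Carrier
    a⁻¹ = proj₁ (inverse a a≉0)
    γ = - b * a⁻¹

    γa≈-b : γ * a ≈ - b
    γa≈-b = begin
      - b * a⁻¹ * a   ≈⟨ *-assoc _ _ _ ⟩
      - b * (a⁻¹ * a) ≈⟨ *-congˡ (≈-trans (*-comm _ _) (proj₂ (inverse a a≉0))) ⟩
      - b * 1#        ≈⟨ *-identityʳ _ ⟩
      - b             ∎

    γ≉0 : ¬ (γ ≈ 0#)
    γ≉0 γ≈0 = b≉0 (begin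
      b          ≈⟨ +-identityʳ b ⟨
      b + 0#     ≈⟨ +-congˡ (*-zeroˡ γ≈0) ⟨
      b + γ * a  ≈⟨ +-congˡ γa≈-b ⟩
      b - b      ≈⟨ -‿inverseʳ b ⟩
      0#         ∎)

    root : ∀ ρ′ → eval p (ρ′ [ i ≔ γ ]) ≈ 0#
    root ρ′ = begin
      eval p (ρ′ [ i ≔ γ ])                               ≈⟨ eval-affine i ro ρ′ γ ⟩
      eval p (ρ′ [ i ≔ 0# ]) + γ * eval (∂ i p) ρ′  ≈⟨ +-cong (intercept ρ′) (*-congˡ (slope ρ′)) ⟩
      b + γ * a                                           ≈⟨ +-congˡ γa≈-b ⟩
      b - b                                               ≈⟨ -‿inverseʳ b ⟩
      0#                                                  ∎

  -- The coefficient is that of `p` for the part `L₁` of `L` occurring in `p`, times the derivative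
  -- of `q` along the rest. If `L₁` is nonempty, the first factor vanishes by hypothesis. If it is
  -- empty, `p` depends on `xᵢ` only, and either `univariate-factor` applies or `q` lacks `j`.
  coefficient-⊗ : ∀ {i p q} → RO p → Disjoint p q → Irreducible (p ⊗ q) → Occurs i p →
    CoefficientVanishes i p → CoefficientVanishes i (p ⊗ q)
  coefficient-⊗ {i} {p} {q} ro disj irr i∈p cv {j} {L} j∈L i∉L within ρ with split p L
  ... | record { L₁ = L₁@(_ ∷ _) ; interleaving = s ; present = present ; absent = absent ; cover = cover } =
    λ h → cv (here ≡.refl) (i∉L ∘ proj₁ ∘ present) within₁ ρ λ p≈0 →
      h (≈-trans (D-⊗ p q s (disj ∘ proj₂ ∘ present) absent _) (*-zeroˡ p≈0))
    where
    within₁ : Within (i ∷ L₁) p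
    within₁ k∈p with within (inj₁ k∈p)
    ... | here k≡i  = here k≡i
    ... | there k∈L = [ there , (λ k∈L₂ → ⊥-elim (absent k∈L₂ k∈p)) ] (cover k∈L)
  ... | record { L₁ = [] ; L₂ = L₂ ; interleaving = s ; absent = absent ; cover = cover } = goal
    where
    ∈L₂ : ∀ {k} → k ∈ L → k ∈ L₂
    ∈L₂ k∈L = [ (λ ()) , id ] (cover k∈L)

    only-i : ∀ {k} → Occurs k p → k ≡ i
    only-i k∈p with within (inj₁ k∈p)
    ... | here k≡i  = k≡i
    ... | there k∈L = ⊥-elim (absent (∈L₂ k∈L) k∈p)

    product : D L (eval (p ⊗ q)) (ρ [ i ≔ 0# ])
            ≈ eval p (ρ [ i ≔ 0# ]) * D L₂ (eval q) (ρ [ i ≔ 0# ])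
    product = D-⊗ p q s (λ ()) absent _

    goal : ¬ ¬ (D L (eval (p ⊗ q)) (ρ [ i ≔ 0# ]) ≈ 0#)
    goal h with occurs? j q
    ... | yes j∈q = univariate-factor ro disj irr i∈p only-i j∈q ρ λ p≈0 →
      h (≈-trans product (*-zeroˡ p≈0))
    ... | no j∉q = h (≈-trans product (*-zeroʳ (D-absent q (∈L₂ j∈L) j∉q _)))

  -- Irreducibility passes down to the child that contains `i`. The gate lemmas expect this child on
  -- the left; for the other side the gate is swapped.
  irreducible⇒coefficient-vanishes : ∀ {i e} → RO e → Irreducible e → Occurs i e →
    CoefficientVanishes i e
  irreducible⇒coefficient-vanishes (var k) irr ≡.refl j∈L i∉L within ρ h =
    h (D-absent (var k) j∈L (λ { ≡.refl → i∉L j∈L }) _)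
  irreducible⇒coefficient-vanishes (add r s disj) irr (inj₁ i∈p) =
    coefficient-⊕ disj irr i∈p
      (irreducible⇒coefficient-vanishes r (irreducible-summand disj irr) i∈p)
  irreducible⇒coefficient-vanishes {i} (add {p} {q} r s disj) irr (inj₂ i∈q) =
    coefficient-≗ {e = q ⊕ p} {p ⊕ q} (λ ρ → +-comm _ _) Sum.swap (coefficient-⊕ disj′ irr′ i∈q
      (irreducible⇒coefficient-vanishes s (irreducible-summand disj′ irr′) i∈q))
    where
    disj′ : Disjoint q p
    disj′ k∈q k∈p = disj k∈p k∈q
    irr′ : Irreducible (q ⊕ p)
    irr′ = irreducible-≗ {p ⊕ q} (λ ρ → +-comm _ _) Sum.swap irr
  irreducible⇒coefficient-vanishes (mul r s disj) irr (inj₁ i∈p) =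
    coefficient-⊗ r disj irr i∈p
      (irreducible⇒coefficient-vanishes r (irreducible-factor disj irr) i∈p)
  irreducible⇒coefficient-vanishes {i} (mul {p} {q} r s disj) irr (inj₂ i∈q) =
    coefficient-≗ {e = q ⊗ p} {p ⊗ q} (λ ρ → *-comm _ _) Sum.swap (coefficient-⊗ s disj′ irr′ i∈q
      (irreducible⇒coefficient-vanishes s (irreducible-factor disj′ irr′) i∈q))
    where
    disj′ : Disjoint q p
    disj′ k∈q k∈p = disj k∈p k∈q
    irr′ : Irreducible (q ⊗ p)
    irr′ = irreducible-≗ {p ⊗ q} (λ ρ → *-comm _ _) Sum.swap irr

  -- The polynomials `M_L^{α,β}` under restriction and differentiation.

  combination : List (Fin n) → Carrier → Carrier → Env → Carrier
  combination L α β ρ = α * ∏ (map ρ L) + β * σ (map ρ L)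

  combination-↭ : ∀ {L L′} α β → L ↭ L′ → ∀ ρ → combination L α β ρ ≈ combination L′ α β ρ
  combination-↭ α β p ρ = +-cong (*-congˡ (∏-↭ (map⁺ ρ p))) (*-congˡ (σ-↭ (map⁺ ρ p)))

  map-≔ : ∀ {i L} → i ∉ L → ∀ ρ a → map (ρ [ i ≔ a ]) L ≡ map ρ L
  map-≔ {i} {L} i∉L ρ a = List.map-cong-local
    (ListAll.tabulate λ j∈L → ≔-other ρ a λ { ≡.refl → i∉L j∈L })

  -- Moving `xᵢ` into the two coefficients yields both operations: substituting a value for `xᵢ`
  -- gives the restriction, and the difference at 1 and 0 gives the derivative.
  combination-∷ : ∀ i L α β ρ →
    combination (i ∷ L) α β ρ ≈ combination L (α * ρ i + β) (β * ρ i) ρ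
  combination-∷ i L α β ρ =
    solve 5 (λ α β x P S → α :* (x :* P) :+ β :* (P :+ x :* S)
                        := (α :* x :+ β) :* P :+ (β :* x) :* S) ≈-refl α β (ρ i) _ _

  combination-∷-≔ : ∀ {i L} → i ∉ L → ∀ α β ρ a →
    combination (i ∷ L) α β (ρ [ i ≔ a ]) ≈ combination L (α * a + β) (β * a) ρ
  combination-∷-≔ {i} {L} i∉L α β ρ a = begin
    combination (i ∷ L) α β (ρ [ i ≔ a ]) ≈⟨ combination-∷ i L α β _ ⟩
    combination L (α * (ρ [ i ≔ a ]) i + β) (β * (ρ [ i ≔ a ]) i) (ρ [ i ≔ a ])
      ≡⟨ ≡.cong₂ (λ x xs → (α * x + β) * ∏ xs + (β * x) * σ xs) (≔-same ρ i a) (map-≔ i∉L ρ a) ⟩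
    combination L (α * a + β) (β * a) ρ ∎

  D-combination : ∀ {i L} → i ∉ L → ∀ α β ρ →
    D (i ∷ []) (combination (i ∷ L) α β) ρ ≈ combination L α β ρ
  D-combination {i} {L} i∉L α β ρ = begin
    combination (i ∷ L) α β (ρ [ i ≔ 1# ]) - combination (i ∷ L) α β (ρ [ i ≔ 0# ])
      ≈⟨ sub-cong (at 1#) (at 0#) ⟩
    (1# * m + t) - (0# * m + t)
      ≈⟨ sub-cong (+-congʳ (*-identityˡ m)) (≈-trans (+-congʳ (zeroˡ m)) (+-identityˡ t)) ⟩
    (m + t) - t ≈⟨ add-sub m t ⟩
    m ∎
    where
    m t : Carrier
    m = combination L α β ρ
    t = β * ∏ (map ρ L)
    at : ∀ a → combination (i ∷ L) α β (ρ [ i ≔ a ]) ≈ a * m + t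
    at a = ≈-trans (combination-∷-≔ i∉L α β ρ a)
      (solve 5 (λ α β a P S → (α :* a :+ β) :* P :+ (β :* a) :* S
                           := a :* (α :* P :+ β :* S) :+ β :* P) ≈-refl α β a _ _)

  Fixed : List (Fin n) → (Env → Carrier) → Set (c ⊔ ℓ)
  Fixed L f = ∀ {i} → i ∈ L → ∀ ρ a → f (ρ [ i ≔ a ]) ≈ f ρ

  -- Only the product term has full degree in `L`, so its coefficient `A` remains. The coefficients
  -- are functions because peeling off a variable by `combination-∷` puts it into them.
  D-all-combination : ∀ {L} → Unique L → ∀ A B → Fixed L A → Fixed L B →
    ∀ ρ → D L (λ ρ → combination L (A ρ) (B ρ) ρ) ρ ≈ A ρ
  D-all-combination {[]} u A B fixA fixB ρ =
    ≈-trans (+-cong (*-identityʳ _) (zeroʳ _)) (+-identityʳ _)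
  D-all-combination {i ∷ L} (i∉L ∷ u) A B fixA fixB ρ = begin
    D L f (ρ [ i ≔ 1# ]) - D L f (ρ [ i ≔ 0# ]) ≈⟨ sub-cong (ih 1#) (ih 0#) ⟩
    (A ρ * 1# + B ρ) - (A ρ * 0# + B ρ)
      ≈⟨ sub-cong (+-congʳ (*-identityʳ _)) (≈-trans (+-congʳ (zeroʳ _)) (+-identityˡ _)) ⟩
    (A ρ + B ρ) - B ρ ≈⟨ add-sub _ _ ⟩
    A ρ ∎
    where
    f : Env → Carrier
    f ρ = combination (i ∷ L) (A ρ) (B ρ) ρ
    at-i : ∀ {j} → j ∈ L → ∀ ρ a → (ρ [ j ≔ a ]) i ≈ ρ i
    at-i j∈L ρ a = reflexive (≔-other ρ a (ListAll.lookup i∉L j∈L))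
    ih : ∀ a → D L f (ρ [ i ≔ a ]) ≈ A ρ * a + B ρ
    ih a = begin
      D L f (ρ [ i ≔ a ])
        ≈⟨ D-cong L (λ ρ → combination-∷ i L (A ρ) (B ρ) ρ) _ ⟩
      D L (λ ρ → combination L (A ρ * ρ i + B ρ) (B ρ * ρ i) ρ) (ρ [ i ≔ a ])
        ≈⟨ D-all-combination u _ _
             (λ j∈L ρ a → +-cong (*-cong (fixA (there j∈L) ρ a) (at-i j∈L ρ a)) (fixB (there j∈L) ρ a))
             (λ j∈L ρ a → *-cong (fixB (there j∈L) ρ a) (at-i j∈L ρ a)) _ ⟩
      A (ρ [ i ≔ a ]) * (ρ [ i ≔ a ]) i + B (ρ [ i ≔ a ])
        ≈⟨ +-cong (*-cong (fixA (here ≡.refl) ρ a) (reflexive (≔-same ρ i a))) (fixB (here ≡.refl) ρ a) ⟩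
      A ρ * a + B ρ ∎

  -- At `xᵢ = 0` the product of the variables in `L` survives only as the term of the symmetric part
  -- that omits `xᵢ`.
  D-combination-coefficient : ∀ {i L} → Unique (i ∷ L) → ∀ α β ρ →
    D L (combination (i ∷ L) α β) (ρ [ i ≔ 0# ]) ≈ β
  D-combination-coefficient {i} {L} (i∉L ∷ u) α β ρ = begin
    D L (combination (i ∷ L) α β) (ρ [ i ≔ 0# ]) ≈⟨ D-cong L (combination-∷ i L α β) _ ⟩
    D L (λ ρ → combination L (α * ρ i + β) (β * ρ i) ρ) (ρ [ i ≔ 0# ])
      ≈⟨ D-all-combination u _ _ (λ j∈L ρ a → +-congʳ (*-congˡ (at-i j∈L ρ a)))
           (λ j∈L ρ a → *-congˡ (at-i j∈L ρ a)) _ ⟩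
    α * (ρ [ i ≔ 0# ]) i + β ≈⟨ +-congʳ (*-zeroʳ (reflexive (≔-same ρ i 0#))) ⟩
    0# + β ≈⟨ +-identityˡ β ⟩
    β ∎
    where
    at-i : ∀ {j} → j ∈ L → ∀ ρ a → (ρ [ j ≔ a ]) i ≈ ρ i
    at-i j∈L ρ a = reflexive (≔-other ρ a (ListAll.lookup i∉L j∈L))

  -- Representations as sums of read-once expressions.

  sum : List (Expr n) → Env → Carrier
  sum []       ρ = 0#
  sum (t ∷ ts) ρ = eval t ρ + sum ts ρ

  sum-↭ : ∀ {ts ts′} → ts ↭ ts′ → ∀ ρ → sum ts ρ ≈ sum ts′ ρ
  sum-↭ refl         ρ = ≈-refl
  sum-↭ (prep t p)   ρ = +-congˡ (sum-↭ p ρ)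
  sum-↭ (swap t u p) ρ = ≈-trans (+-congˡ (+-congˡ (sum-↭ p ρ)))
    (solve 3 (λ x y z → x :+ (y :+ z) := y :+ (x :+ z)) ≈-refl _ _ _)
  sum-↭ (trans p q)  ρ = ≈-trans (sum-↭ p ρ) (sum-↭ q ρ)

  sum-∂ : ∀ {ts} i → ListAll RO ts → ∀ ρ → sum (map (∂ i) ts) ρ ≈ D (i ∷ []) (sum ts) ρ
  sum-∂ i []       ρ = ≈-sym (D-0 (i ∷ []) ρ)
  sum-∂ {t ∷ ts} i (r ∷ rs) ρ = ≈-trans (+-cong (eval-∂ i r ρ) (sum-∂ i rs ρ))
    (≈-sym (D-+ (i ∷ []) (eval t) (sum ts) ρ))

  sum-restrict : ∀ ts i a ρ → sum (map (restrict i a) ts) ρ ≈ sum ts (ρ [ i ≔ a ])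
  sum-restrict []       i a ρ = ≈-refl
  sum-restrict (t ∷ ts) i a ρ = +-cong (eval-restrict i a t ρ) (sum-restrict ts i a ρ)

  -- Finitely many doubly negated equations may be assumed together, because the goal is itself a
  -- negation.
  D-sum-vanishes : ∀ L {ts} ρ → ListAll (λ t → ¬ ¬ (D L (eval t) ρ ≈ 0#)) ts →
    ¬ ¬ (D L (sum ts) ρ ≈ 0#)
  D-sum-vanishes L ρ [] h = h (D-0 L ρ)
  D-sum-vanishes L {t ∷ ts} ρ (v ∷ vs) h = v λ t≈0 → D-sum-vanishes L ρ vs λ ts≈0 →
    h (≈-trans (D-+ L (eval t) (sum ts) ρ) (≈-trans (+-cong t≈0 ts≈0) (+-identityʳ 0#)))

  -- The invariant of the induction. `within` confines the summands to the variables in `L`, as the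
  -- coefficient argument requires, and `β≉0` supplies the contradiction.
  record Represents (ts : List (Expr n)) (L : List (Fin n)) (α β : Carrier) : Set (c ⊔ ℓ) where
    constructor represents
    field
      unique   : Unique L
      readOnce : ListAll RO ts
      within   : ListAll (Within L) ts
      β≉0      : ¬ (β ≈ 0#)
      equation : ∀ ρ → sum ts ρ ≈ combination L α β ρ

  represents-↭ : ∀ {ts ts′ L L′ α β} → ts ↭ ts′ → L ↭ L′ →
    Represents ts L α β → Represents ts′ L′ α β
  represents-↭ {α = α} {β} p q (represents u rs ws β≉0 eq) = represents
    (Unique-resp-↭ q u)
    (All-resp-↭ p rs)
    (ListAll.map (λ w {_} k∈ → ∈-resp-↭ q (w k∈)) (All-resp-↭ p ws))
    β≉0
    (λ ρ → ≈-trans (sum-↭ (↭-sym p) ρ) (≈-trans (eq ρ) (combination-↭ α β q ρ)))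

  represents-drop : ∀ {t ts L α β} → (∀ ρ → eval t ρ ≈ 0#) →
    Represents (t ∷ ts) L α β → Represents ts L α β
  represents-drop t≈0 (represents u (_ ∷ rs) (_ ∷ ws) β≉0 eq) = represents u rs ws β≉0
    λ ρ → ≈-trans (≈-sym (≈-trans (+-congʳ (t≈0 ρ)) (+-identityˡ _))) (eq ρ)

  within-tail : ∀ {i L} e e′ →
    (∀ {k} → Occurs k e′ → Occurs k e × k ≢ i) → Within (i ∷ L) e → Within L e′
  within-tail e e′ occ w k∈ with k∈e , k≢i ← occ k∈ with w k∈e
  ... | here k≡i  = ⊥-elim (k≢i k≡i)
  ... | there k∈L = k∈L

  within-∂ : ∀ {i L ts} → ListAll RO ts → ListAll (Within (i ∷ L)) ts → ListAll (Within L) (map (∂ i) ts)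
  within-∂ []       []       = []
  within-∂ {ts = t ∷ _} (r ∷ rs) (w ∷ ws) = within-tail t (∂ _ t) (occurs-∂ r) w ∷ within-∂ rs ws

  within-restrict : ∀ {i L a ts} → ListAll (Within (i ∷ L)) ts → ListAll (Within L) (map (restrict i a) ts)
  within-restrict []               = []
  within-restrict {ts = t ∷ _} (w ∷ ws) = within-tail t (restrict _ _ t) (occurs-restrict t) w ∷ within-restrict ws

  represents-∂ : ∀ {ts i L α β} → Represents ts (i ∷ L) α β → Represents (map (∂ i) ts) L α β
  represents-∂ {ts} {i} {L} {α} {β} (represents (i∉L ∷ u) rs ws β≉0 eq) = represents u
    (ListAll-map⁺ (ListAll.map (RO-∂ i) rs))
    (within-∂ rs ws)
    β≉0
    λ ρ → ≈-trans (sum-∂ i rs ρ)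
      (≈-trans (D-cong (i ∷ []) eq ρ) (D-combination (All¬⇒¬Any i∉L) α β ρ))

  -- The substituted value must be nonzero so that the new `β * a` is nonzero again.
  represents-restrict : ∀ {ts i L α β a} → ¬ (a ≈ 0#) → Represents ts (i ∷ L) α β →
    Represents (map (restrict i a) ts) L (α * a + β) (β * a)
  represents-restrict {ts} {i} {L} {α} {β} {a} a≉0 (represents (i∉L ∷ u) rs ws β≉0 eq) = represents u
    (ListAll-map⁺ (ListAll.map (RO-restrict i a) rs))
    (within-restrict ws)
    (*-nonzero β≉0 a≉0)
    λ ρ → ≈-trans (sum-restrict ts i a ρ)
      (≈-trans (eq _) (combination-∷-≔ (All¬⇒¬Any i∉L) α β ρ a))

  -- Induction on the number of summands.

  ∈-↭₂ : ∀ {i j : Fin n} {L} → i ≢ j → i ∈ L → j ∈ L → ∃ λ L′ → L ↭ i ∷ j ∷ L′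
  ∈-↭₂ i≢j i∈L j∈L with L₁ , p ← ∈-↭ i∈L with ∈-resp-↭ p j∈L
  ... | here j≡i   = ⊥-elim (i≢j (≡.sym j≡i))
  ... | there j∈L₁ with L₂ , q ← ∈-↭ j∈L₁ = L₂ , trans p (prep _ q)

  shorter : ∀ {k m i j} {L L′ : List (Fin n)} → L ↭ i ∷ j ∷ L′ → suc m ≡ suc k →
    suc k ℕ.+ suc k < length L → m ℕ.+ m < length L′
  shorter {k} p ≡.refl lt = ℕ.≤-pred (ℕ.≤-pred
    (≡.subst₂ _<_ (≡.cong suc (ℕ.+-suc k k)) (↭-length p) lt))

  -- Mutual recursion on `k`: at `suc k` the two reductions show that every summand is irreducible,
  -- and they in turn appeal to the case `k`.
  no-representation : ∀ k {ts L α β} → length ts ≡ k → k ℕ.+ k < length L →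
    ¬ Represents ts L α β

  reduce-∂∂ : ∀ {k ts L α β t i j} → length ts ≡ suc k → suc k ℕ.+ suc k < length L →
    Represents ts L α β → t ∈ ts → i ≢ j → i ∈ L → j ∈ L →
    ¬ (∀ ρ → D (i ∷ j ∷ []) (eval t) ρ ≈ 0#)

  reduce-∂| : ∀ {k ts L α β t i j a} → length ts ≡ suc k → suc k ℕ.+ suc k < length L →
    Represents ts L α β → t ∈ ts → i ≢ j → i ∈ L → j ∈ L → ¬ (a ≈ 0#) →
    ¬ (∀ ρ → D (i ∷ []) (eval t) (ρ [ j ≔ a ]) ≈ 0#)

  reduce-∂∂ {k} {t = t} {i} {j} len lt R t∈ts i≢j i∈L j∈L h
    -- `D (i ∷ j ∷ [])` differentiates by `j` first, so `j` is brought to the front of `L`, before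
    -- `i`.
    with ts′ , p ← ∈-↭ t∈ts | L′ , q ← ∈-↭₂ (i≢j ∘ ≡.sym) j∈L i∈L
    with R′@(represents _ (r ∷ _) _ _ _) ← represents-↭ p q R =
    no-representation k len′ lt′ (represents-drop zero′ (represents-∂ (represents-∂ R′)))
    where
    len″ = ≡.trans (≡.sym (↭-length p)) len
    len′ = ≡.trans (List.length-map (∂ i) (map (∂ j) ts′))
             (≡.trans (List.length-map (∂ j) ts′) (ℕ.suc-injective len″))
    lt′ = subst (λ m → m ℕ.+ m < length L′) (ℕ.suc-injective len″) (shorter q len″ lt)
    zero′ : ∀ ρ → eval (∂ i (∂ j t)) ρ ≈ 0#
    zero′ ρ = ≈-trans (eval-∂ i (RO-∂ j r) ρ) (≈-trans (D-cong (i ∷ []) (eval-∂ j r) ρ) (h ρ))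

  reduce-∂| {k} {t = t} {i} {j} {a} len lt R t∈ts i≢j i∈L j∈L a≉0 h
    with ts′ , p ← ∈-↭ t∈ts | L′ , q ← ∈-↭₂ i≢j i∈L j∈L
    with R′@(represents _ (r ∷ _) _ _ _) ← represents-↭ p q R =
    no-representation k len′ lt′ (represents-drop zero′ (represents-restrict a≉0 (represents-∂ R′)))
    where
    len″ = ≡.trans (≡.sym (↭-length p)) len
    len′ = ≡.trans (List.length-map (restrict j a) (map (∂ i) ts′))
             (≡.trans (List.length-map (∂ i) ts′) (ℕ.suc-injective len″))
    lt′ = subst (λ m → m ℕ.+ m < length L′) (ℕ.suc-injective len″) (shorter q len″ lt)
    zero′ : ∀ ρ → eval (restrict j a (∂ i t)) ρ ≈ 0#
    zero′ ρ = ≈-trans (eval-restrict j a (∂ i t) ρ) (≈-trans (eval-∂ i r _) (h ρ))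

  -- Comparing the coefficients of ∏ L on both sides of the representation.
  some-coefficient : ∀ {ts i L α β} → Represents ts (i ∷ L) α β →
    ¬ (∀ {t} → t ∈ ts → ¬ ¬ (D L (eval t) (K 0# [ i ≔ 0# ]) ≈ 0#))
  some-coefficient {ts} {i} {L} {α} {β} (represents u _ _ β≉0 eq) v =
    D-sum-vanishes L _ (ListAll.tabulate v) λ s≈0 → β≉0 (begin
      β                                               ≈⟨ D-combination-coefficient u α β (K 0#) ⟨
      D L (combination (i ∷ L) α β) (K 0# [ i ≔ 0# ]) ≈⟨ D-cong L eq _ ⟨
      D L (sum ts) (K 0# [ i ≔ 0# ])                  ≈⟨ s≈0 ⟩
      0#                                              ∎)

  -- Without summands there is no coefficient to check, and `β` would be 0.
  no-representation zero {[]} {i ∷ L} len lt R = some-coefficient R λ ()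
  no-representation (suc k) {L = i ∷ []} len (s≤s ())
  no-representation (suc k) {ts} {i ∷ j ∷ L} len lt R@(represents (i∉L ∷ u) rs ws _ _) =
    some-coefficient R vanish
    where
    vanish : ∀ {t} → t ∈ ts → ¬ ¬ (D (j ∷ L) (eval t) (K 0# [ i ≔ 0# ]) ≈ 0#)
    vanish {t} t∈ts with occurs? i t
    ... | yes i∈t = irreducible⇒coefficient-vanishes (ListAll.lookup rs t∈ts) irr i∈t
          (here ≡.refl) (All¬⇒¬Any i∉L) w (K 0#)
      where
      w : Within (i ∷ j ∷ L) t
      w = ListAll.lookup ws t∈ts
      -- An operation annihilating `t` would leave a representation with one summand and two
      -- variables fewer.
      irr : Irreducible t
      irr .∂∂≉0 p≢q p∈ q∈ = reduce-∂∂ len lt R t∈ts p≢q (w p∈) (w q∈)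
      irr .∂|≉0 p≢q p∈ q∈ = reduce-∂| len lt R t∈ts p≢q (w p∈) (w q∈)
    -- A summand without `xᵢ` is annihilated by `∂ᵢ∂ⱼ` at once.
    ... | no i∉t = ⊥-elim (reduce-∂∂ len lt R t∈ts (ListAll.lookup i∉L (here ≡.refl))
          (here ≡.refl) (there (here ≡.refl)) (D-absent {i ∷ j ∷ []} t (here ≡.refl) i∉t))

  -- From polynomial identities to representations, and the theorem.

  private module S = ReadOnceSums F

  eval-∏ : ∀ L ρ → eval (S.∏ (map var L)) ρ ≡ ∏ (map ρ L)
  eval-∏ []      ρ = ≡.refl
  eval-∏ (i ∷ L) ρ = ≡.cong (ρ i *_) (eval-∏ L ρ)

  eval-σ : ∀ L ρ → eval (S.σ (map var L)) ρ ≡ σ (map ρ L)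
  eval-σ []      ρ = ≡.refl
  eval-σ (i ∷ L) ρ = ≡.cong₂ (λ P Q → P + ρ i * Q) (eval-∏ L ρ) (eval-σ L ρ)

  readOnce-summands : ∀ {k} {ps : Vec (Expr n) k} → All IsROP ps →
    ∃ λ ts → length ts ≡ k × ListAll RO ts × (∀ ρ → eval (sumE ps) ρ ≈ sum ts ρ)
  readOnce-summands [] = [] , ≡.refl , [] , λ ρ → ≈-refl
  readOnce-summands (p ∷ ps) with t , r , p≋t ← isROP⇒RO p | ts , len , rs , eq ← readOnce-summands ps =
    t ∷ ts , ≡.cong suc len , r ∷ rs , λ ρ → +-cong (eval-≋ p≋t ρ) (eq ρ)

  double-< : ∀ k m → k < ⌈ m /2⌉ → k ℕ.+ k < m
  double-< zero    (suc m)       _        = s≤s z≤n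
  double-< (suc k) (suc (suc m)) (s≤s lt) =
    s≤s (≡.subst (_< suc m) (≡.sym (ℕ.+-suc k k)) (s≤s (double-< k m lt)))
  double-< (suc k) (suc zero)    (s≤s ())

  lower-bound : 1 ≤ n → ∀ k → k < ⌈ n /2⌉ → (ps : Vec (Expr n) k) → All IsROP ps →
    ¬ (P.esym n (n ∸ 1) ≋ sumE ps)
  lower-bound 1≤n k lt ps rops eq with ts , len , rs , ps≈ts ← readOnce-summands rops =
    no-representation k len
      (subst (k ℕ.+ k <_) (≡.sym (List.length-tabulate id)) (double-< k n lt))
      -- The symmetric polynomial is the case `α = 0`, `β = 1`, so `β` is nonzero because `0# ≈ 1#`
      -- is excluded.
      (represents (allFin⁺ n) rs (ListAll.map (λ _ {i} _ → ∈-allFin i) rs) (0≉1 ∘ ≈-sym) λ ρ → begin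
        sum ts ρ                         ≈⟨ ps≈ts ρ ⟨
        eval (sumE ps) ρ                 ≈⟨ eval-≋ eq ρ ⟨
        eval (P.esym n (n ∸ 1)) ρ        ≈⟨ eval-≋ (S.esym-σ n 1≤n) ρ ⟩
        eval (S.σ (map var (allFin n))) ρ ≡⟨ eval-σ (allFin n) ρ ⟩
        σ (map ρ (allFin n))             ≈⟨ ≈-trans (+-cong (zeroˡ _) (*-identityˡ _)) (+-identityˡ _) ⟨
        combination (allFin n) 0# 1# ρ   ∎)

theorem1 : ∀ {c ℓ : Level} (F : Field c ℓ) (n : ℕ) → 1 ≤ n →
    let open Poly F in
    (∀ (k : ℕ) → k < ⌈ n /2⌉ → (ps : Vec (Expr n) k) → All IsROP ps →
    ¬ (esym n (n ∸ 1) ≋ sumE ps))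
    × Σ (Vec (Expr n) ⌈ n /2⌉) (λ ps → All IsROP ps × (esym n (n ∸ 1) ≋ sumE ps))
theorem1 F n 1≤n = LowerBound.lower-bound F n 1≤n , ReadOnceSums.upper-bound F n 1≤n
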